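{- For all integers $n\ge 2$ and $1\le k<n$, the domination number of $H_B(n,k)$ is $\gamma(H_B(n,k))=\binom{n}{k}$.
   Context: Fix integers $n\ge 2$ and $1\le k<n$ and positive real numbers $x_1<x_2<\dots<x_n$. Let $\mathscr{B}_n=\{\pm x_1,\pm x_2,\dots,\pm x_{n-1},x_n\}$ (so $-x_n\notin\mathscr{B}_n$). Let $\phi(\mathscr{B}_n)$ be the family of all nonempty subsets $S\subseteq\mathscr{B}_n$ whose elements have pairwise distinct absolute values and whose element of largest absolute value is positive. Let $\mathscr{B}_n^+=\{x_1,\dots,x_n\}$, let $V_1$ be the set of all $k$-element subsets of $\mathscr{B}_n^+$, and let $V_2=\phi(\mathscr{B}_n)\setminus V_1$. For $A\in\phi(\mathscr{B}_n)$ put $A^\dagger=\{|a|:a\in A\}$. The bipartite Kneser B type-$k$ graph $H_B(n,k)$ is the simple graph with vertex set $V_1\cup V_2$ in which $X\in V_1$ and $Y\in V_2$ are adjacent if and only if $X\subseteq Y^\dagger$ or $Y^\dagger\subseteq X$, and there are no other edges. A dominating set is a set $S$ of vertices such that every vertex not in $S$ is adjacent to some vertex of $S$; the domination number is the minimum size of a dominating set. -}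

module Defs where

open import Level using (Level; 0ℓ; _⊔_) renaming (suc to lsuc)
import Algebra.Properties.Group as GroupProperties
open import Data.Nat.Base as ℕ using (ℕ; _∸_)
open import Data.Nat.Properties using (m∸n≤m)
open import Data.Fin.Base using (Fin; inject≤; splitAt)
open import Data.Fin.Subset using (Subset; Nonempty; ∣_∣) renaming (_∈_ to _∈ˢ_)
open import Data.List.Base using (List; length)
open import Data.List.Membership.Propositional using (_∈_; _∉_)
open import Data.List.Relation.Unary.All using (All)
open import Data.List.Relation.Unary.Unique.Propositional using (Unique)
open import Data.Product.Base using (_×_; _,_; ∃; ∃-syntax; proj₁; proj₂; swap)
open import Data.Rational.Base as ℚ using (ℚ; 0ℚ; 1ℚ)
import Data.Rational.Properties as ℚ
open import Data.Sum.Base as Sum using (_⊎_; inj₁; inj₂; [_,_]′)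
open import Function.Base using (_∘_)
open import Relation.Binary.Core using (Rel)
open import Relation.Binary.Definitions using (Symmetric; tri<; tri≈; tri>)
open import Relation.Binary.PropositionalEquality
  using (_≡_; _≢_; refl; sym; subst)
open import Relation.Nullary using (¬_)
open import Relation.Nullary.Decidable using (from-yes)
open import Relation.Unary using (Pred; _⊆_; _∪_)

------------------------------------------------------------------------
-- Real numbers as two-sided (located) Dedekind cuts of ℚ

record ℝ : Set₁ where
  field
    lower upper      : Pred ℚ 0ℓ
    lower-inhabited  : ∃ lower
    upper-inhabited  : ∃ upper
    lower-closed     : ∀ {q r} → q ℚ.< r → lower r → lower q
    upper-closed     : ∀ {q r} → q ℚ.< r → upper q → upper r
    lower-open       : ∀ {q} → lower q → ∃[ r ] q ℚ.< r × lower r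
    upper-open       : ∀ {r} → upper r → ∃[ q ] q ℚ.< r × upper q
    disjoint         : ∀ {q} → ¬ (lower q × upper q)
    located          : ∀ {q r} → q ℚ.< r → lower q ⊎ upper r

open ℝ public

infix 4 _≈_ _≤_ _<_

_≤_ : Rel ℝ 0ℓ
x ≤ y = ∀ q → lower x q → lower y q

_≈_ : Rel ℝ 0ℓ
x ≈ y = x ≤ y × y ≤ x

_<_ : Rel ℝ 0ℓ
x < y = ∃[ q ] upper x q × lower y q

0ℝ : ℝ
0ℝ = record
  { lower           = ℚ._< 0ℚ
  ; upper           = 0ℚ ℚ.<_
  ; lower-inhabited = ℚ.- 1ℚ , from-yes (ℚ.- 1ℚ ℚ.<? 0ℚ)
  ; upper-inhabited = 1ℚ , from-yes (0ℚ ℚ.<? 1ℚ)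
  ; lower-closed    = ℚ.<-trans
  ; upper-closed    = λ q<r 0<q → ℚ.<-trans 0<q q<r
  ; lower-open      = ℚ.<-dense
  ; upper-open      = λ 0<r → let q , 0<q , q<r = ℚ.<-dense 0<r in q , q<r , 0<q
  ; disjoint        = λ (q<0 , 0<q) → ℚ.<-asym q<0 0<q
  ; located         = loc
  }
  where
  loc : ∀ {q r} → q ℚ.< r → q ℚ.< 0ℚ ⊎ 0ℚ ℚ.< r
  loc {q} q<r with ℚ.<-cmp q 0ℚ
  ... | tri< q<0 _ _  = inj₁ q<0
  ... | tri≈ _ refl _ = inj₂ q<r
  ... | tri> _ _ 0<q  = inj₂ (ℚ.<-trans 0<q q<r)

private
  neg-invol : ∀ q → ℚ.- (ℚ.- q) ≡ q
  neg-invol = GroupProperties.⁻¹-involutive ℚ.+-0-group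

  neg-swapˡ : ∀ {p q} → p ℚ.< ℚ.- q → q ℚ.< ℚ.- p
  neg-swapˡ {p} {q} p<-q =
    subst (ℚ._< ℚ.- p) (neg-invol q) (ℚ.neg-antimono-< p<-q)

  neg-swapʳ : ∀ {p q} → ℚ.- q ℚ.< p → ℚ.- p ℚ.< q
  neg-swapʳ {p} {q} -q<p =
    subst (ℚ.- p ℚ.<_) (neg-invol q) (ℚ.neg-antimono-< -q<p)

infix 8 -_

-_ : ℝ → ℝ
- x = record
  { lower           = upper x ∘ ℚ.-_
  ; upper           = lower x ∘ ℚ.-_
  ; lower-inhabited = let q , u = upper-inhabited x in
                      ℚ.- q , subst (upper x) (sym (neg-invol q)) u
  ; upper-inhabited = let q , l = lower-inhabited x in
                      ℚ.- q , subst (lower x) (sym (neg-invol q)) l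
  ; lower-closed    = upper-closed x ∘ ℚ.neg-antimono-<
  ; upper-closed    = lower-closed x ∘ ℚ.neg-antimono-<
  ; lower-open      = λ u → let p , p<-q , v = upper-open x u in
                      ℚ.- p , neg-swapˡ p<-q , subst (upper x) (sym (neg-invol p)) v
  ; upper-open      = λ l → let p , -r<p , m = lower-open x l in
                      ℚ.- p , neg-swapʳ -r<p , subst (lower x) (sym (neg-invol p)) m
  ; disjoint        = disjoint x ∘ swap
  ; located         = Sum.swap ∘ located x ∘ ℚ.neg-antimono-<
  }

-- The maximum of x and - x.
abs : ℝ → ℝ
abs x = record
  { lower           = λ q → lower x q ⊎ lower (- x) q
  ; upper           = λ q → upper x q × upper (- x) q
  ; lower-inhabited = let q , l = lower-inhabited x in q , inj₁ l
  ; upper-inhabited = inhabited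
  ; lower-closed    = λ q<r → Sum.map (lower-closed x q<r) (lower-closed (- x) q<r)
  ; upper-closed    = λ q<r (u , v) → upper-closed x q<r u , upper-closed (- x) q<r v
  ; lower-open      = [ (λ l → let r , q<r , m = lower-open x l in r , q<r , inj₁ m)
                      , (λ l → let r , q<r , m = lower-open (- x) l in r , q<r , inj₂ m)
                      ]′
  ; upper-open      = open′
  ; disjoint        = λ (l , u , v) → [ (λ m → disjoint x (m , u))
                                      , (λ m → disjoint (- x) (m , v)) ]′ l
  ; located         = loc
  }
  where
  inhabited : ∃[ q ] upper x q × upper (- x) q
  inhabited with upper-inhabited x | upper-inhabited (- x)
  ... | p , u | q , v with ℚ.<-cmp p q
  ... | tri< p<q _ _  = q , upper-closed x p<q u , v
  ... | tri≈ _ refl _ = q , u , v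
  ... | tri> _ _ q<p  = p , u , upper-closed (- x) q<p v

  open′ : ∀ {r} → upper x r × upper (- x) r →
          ∃[ q ] q ℚ.< r × upper x q × upper (- x) q
  open′ (u , v) with upper-open x u | upper-open (- x) v
  ... | p , p<r , u′ | q , q<r , v′ with ℚ.<-cmp p q
  ... | tri< p<q _ _  = q , q<r , upper-closed x p<q u′ , v′
  ... | tri≈ _ refl _ = q , q<r , u′ , v′
  ... | tri> _ _ q<p  = p , p<r , u′ , upper-closed (- x) q<p v′

  loc : ∀ {q r} → q ℚ.< r →
        (lower x q ⊎ lower (- x) q) ⊎ (upper x r × upper (- x) r)
  loc q<r with located x q<r | located (- x) q<r
  ... | inj₁ l | _      = inj₁ (inj₁ l)
  ... | inj₂ _ | inj₁ l = inj₁ (inj₂ l)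
  ... | inj₂ u | inj₂ v = inj₂ (u , v)

------------------------------------------------------------------------
-- Simple graphs and domination

-- The vertex set is a subset of an ambient type A.
record SimpleGraph {a} (A : Set a) (v e : Level) : Set (a ⊔ lsuc (v ⊔ e)) where
  field
    Vertex      : Pred A v
    Adj         : Rel A e
    adj-vertex  : ∀ {s t} → Adj s t → Vertex s × Vertex t
    adj-sym     : Symmetric Adj
    adj-irrefl  : ∀ {s} → ¬ Adj s s

module _ {a v e} {A : Set a} (G : SimpleGraph A v e) where
  open SimpleGraph G

  -- A finite set of vertices is a list of vertices without repetitions;
  -- its size is the length of the list.
  record DominatingSet (D : List A) : Set (a ⊔ v ⊔ e) where
    field
      unique     : Unique D
      vertices   : All Vertex D
      dominates  : ∀ {s} → Vertex s → s ∉ D → ∃[ t ] t ∈ D × Adj s t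

  record IsDominationNumber (γ : ℕ) : Set (a ⊔ v ⊔ e) where
    field
      attained  : ∃[ D ] DominatingSet D × length D ≡ γ
      minimal   : ∀ D → DominatingSet D → γ ℕ.≤ length D

------------------------------------------------------------------------
-- The bipartite Kneser B type-k graph

module KneserB (n k : ℕ) (x : Fin n → ℝ) where

  -- 𝓑ₙ is enumerated as x₁,…,xₙ,-x₁,…,-xₙ₋₁, so that a subset of 𝓑ₙ is a
  -- Subset (n + (n ∸ 1)). The enumeration has no repetitions whenever the
  -- xᵢ are positive and strictly increasing.
  Index : Set
  Index = Fin (n ℕ.+ (n ∸ 1))

  element : Index → ℝ
  element i = [ x , (λ j → - x (inject≤ j (m∸n≤m n 1))) ]′ (splitAt n i)

  SubsetB : Set
  SubsetB = Subset (n ℕ.+ (n ∸ 1))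

  ⟦_⟧ : SubsetB → Pred ℝ 0ℓ
  ⟦ S ⟧ r = ∃[ a ] a ∈ˢ S × r ≈ element a

  _† : SubsetB → Pred ℝ 0ℓ
  (S †) r = ∃[ a ] a ∈ˢ S × r ≈ abs (element a)

  𝓑⁺ : Pred ℝ 0ℓ
  𝓑⁺ r = ∃[ i ] r ≈ x i

  record φ (S : SubsetB) : Set where
    field
      nonempty      : Nonempty S
      distinct-abs  : ∀ {a b} → a ∈ˢ S → b ∈ˢ S → a ≢ b →
                      ¬ abs (element a) ≈ abs (element b)
      max-positive  : ∃[ a ] a ∈ˢ S
                           × (∀ {b} → b ∈ˢ S → abs (element b) ≤ abs (element a))
                           × 0ℝ < element a

  V₁ : Pred SubsetB (lsuc 0ℓ)
  V₁ S = ∣ S ∣ ≡ k × ⟦ S ⟧ ⊆ 𝓑⁺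

  V₂ : Pred SubsetB (lsuc 0ℓ)
  V₂ S = φ S × ¬ V₁ S

  Comparable : Rel SubsetB (lsuc 0ℓ)
  Comparable X Y = ⟦ X ⟧ ⊆ (Y †) ⊎ (Y †) ⊆ ⟦ X ⟧

  Adjacent : Rel SubsetB (lsuc 0ℓ)
  Adjacent S T = (V₁ S × V₂ T × Comparable S T)
               ⊎ (V₁ T × V₂ S × Comparable T S)

  H_B : SimpleGraph SubsetB (lsuc 0ℓ) (lsuc 0ℓ)
  H_B = record
    { Vertex      = V₁ ∪ V₂
    ; Adj         = Adjacent
    ; adj-vertex  = λ where
        (inj₁ (v₁ , v₂ , _)) → inj₁ v₁ , inj₂ v₂
        (inj₂ (v₁ , v₂ , _)) → inj₂ v₂ , inj₁ v₁
    ; adj-sym     = Sum.swap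
    ; adj-irrefl  = λ where
        (inj₁ (v₁ , (_ , ¬v₁) , _)) → ¬v₁ v₁
        (inj₂ (v₁ , (_ , ¬v₁) , _)) → ¬v₁ v₁
    }

{-# OPTIONS --safe #-}

-- The k-element subsets of 𝓑⁺ dominate: every nonempty set of absolute values
-- contains, or is contained in, a k-element set.
-- Conversely, let D dominate. If k ≥ 2, changing the sign of a non-maximal
-- element of a k-set X gives a vertex Y of V₂ whose only neighbour is X, so D
-- meets each of the disjoint sets {X , Y}. If k = 1, let {t} be a singleton
-- missing from D. For every other missing {i}, the only neighbours of {i , t}
-- are {i} and {t}, so {i , t} belongs to D; likewise, if there is such an i, so
-- does its copy with a sign changed, which is charged to t. If t is the only
-- missing index, a neighbour of {t} in D is charged to it.
module Submission where

open import Defs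
open import Data.Bool.Properties using () renaming (_≟_ to _≟ᵇ_)
open import Data.Fin.Base as Fin using (Fin; zero; suc; _↑ˡ_; _↑ʳ_; splitAt; inject≤; fromℕ<; toℕ)
import Data.Fin.Properties as Fin
open import Data.Fin.Subset
  using (Subset; Nonempty; inside; outside; ∣_∣; ⊥; ⊤; ⁅_⁆; ∁; _∪_; _∩_)
  renaming (_∈_ to _∈ˢ_; _⊆_ to _⊆ˢ_)
open import Data.Fin.Subset.Properties
open import Data.List.Base using (List; []; _∷_; _++_; map; length; lookup)
open import Data.List.Membership.Propositional using (_∈_; _∉_)
open import Data.List.Membership.Propositional.Properties
  using (∈-map⁺; ∈-map⁻; ∈-++⁺ˡ; ∈-++⁺ʳ; ∈-lookup)
open import Data.List.Properties using (length-map; length-++)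
import Data.List.Relation.Unary.All as All
import Data.List.Relation.Unary.All.Properties as All
open import Data.List.Relation.Unary.AllPairs using ([]; _∷_)
open import Data.List.Relation.Unary.Any using (here; index)
open import Data.List.Relation.Unary.Any.Properties using (lookup-index)
open import Data.List.Relation.Unary.Unique.Propositional using (Unique)
import Data.List.Relation.Unary.Unique.Propositional.Properties as Unique
open import Data.Nat.Base as ℕ using (ℕ; zero; suc; _∸_; z≤n; s≤s)
open import Data.Nat.Combinatorics using (_C_; nC1≡n; nCk+nC[k+1]≡[n+1]C[k+1])
import Data.Nat.Properties as ℕ
open import Data.Product.Base using (_×_; _,_; ∃-syntax; proj₁; proj₂)
open import Data.Rational.Base as ℚ using ()
import Data.Rational.Properties as ℚ
import Algebra.Properties.Group as GroupProperties
open import Data.Sum.Base as Sum using (_⊎_; inj₁; inj₂; [_,_]′)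
open import Data.Vec.Base as Vec using ([]; _∷_; here; there)
import Data.Vec.Properties as Vec
open import Function.Base using (id; _∘_)
open import Relation.Binary.Definitions using (tri<; tri≈; tri>)
open import Relation.Binary.PropositionalEquality
  using (_≡_; _≢_; refl; sym; trans; cong; cong₂; subst)
open import Relation.Nullary using (¬_; yes; no; contradiction)
open import Relation.Nullary.Decidable using (does; dec-true; _×-dec_; ¬?)
open import Relation.Unary using (Pred; Decidable)

-- Real numbers

≈-sym : ∀ x y → x ≈ y → y ≈ x
≈-sym _ _ (x≤y , y≤x) = y≤x , x≤y

≈-trans : ∀ x y z → x ≈ y → y ≈ z → x ≈ z
≈-trans _ _ _ (x≤y , y≤x) (y≤z , z≤y) = (λ q → y≤z q ∘ x≤y q) , (λ q → y≤x q ∘ z≤y q)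

≈-refl : ∀ x → x ≈ x
≈-refl _ = (λ _ → id) , (λ _ → id)

lower<upper : ∀ x {p q} → lower x p → upper x q → p ℚ.< q
lower<upper x {p} {q} l u with ℚ.<-cmp p q
... | tri< p<q _ _  = p<q
... | tri≈ _ refl _ = contradiction (l , u) (disjoint x)
... | tri> _ _ q<p  = contradiction (l , upper-closed x q<p u) (disjoint x)

<⇒≤ : ∀ x y → x < y → x ≤ y
<⇒≤ x y (_ , u , l) p m = lower-closed y (lower<upper x m u) l

<⇒≱ : ∀ x y → x < y → ¬ y ≤ x
<⇒≱ x _ (q , u , l) y≤x = disjoint x (y≤x q l , u)

neg-involutive : ∀ q → ℚ.- (ℚ.- q) ≡ q
neg-involutive = GroupProperties.⁻¹-involutive ℚ.+-0-group

-- A positive rational below `x` would also lie below `- y`, so its negative would be an upper bound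
-- of `y`; but `y` has a positive lower bound.
pos≰neg : ∀ x y → 0ℝ < x → 0ℝ < y → ¬ x ≤ - y
pos≰neg _ y (p , 0<p , l) (_ , 0<q , m) x≤-y =
  ℚ.<-asym (ℚ.<-trans 0<q (lower<upper y m (x≤-y p l))) (ℚ.neg-antimono-< 0<p)

-x≤x : ∀ x → 0ℝ < x → - x ≤ x
-x≤x x (p , 0<p , l) q u = lower-closed x (ℚ.<-trans q<0 0<p) l
  where
  q<0 : q ℚ.< ℚ.0ℚ
  q<0 = subst (ℚ._< ℚ.0ℚ) (neg-involutive q)
          (ℚ.neg-antimono-< (ℚ.<-trans 0<p (lower<upper x l u)))

abs-pos : ∀ x → 0ℝ < x → abs x ≈ x
abs-pos x 0<x = (λ q → [ id , -x≤x x 0<x q ]′) , (λ _ → inj₁)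

abs-neg : ∀ x → 0ℝ < x → abs (- x) ≈ x
abs-neg x 0<x =
    (λ q → [ -x≤x x 0<x q , subst (lower x) (neg-involutive q) ]′)
  , (λ q → inj₂ ∘ subst (lower x) (sym (neg-involutive q)))

-- Finite subsets

module _ {m n : ℕ} {p : Subset m} {q : Subset n} where

  ∈-++⁺ˢˡ : ∀ {i} → i ∈ˢ p → (i ↑ˡ n) ∈ˢ (p Vec.++ q)
  ∈-++⁺ˢˡ {i} i∈p = Vec.lookup⇒[]= (i ↑ˡ n) _
    (trans (Vec.lookup-++ˡ p q i) (Vec.[]=⇒lookup i∈p))

  ∈-++⁺ˢʳ : ∀ {j} → j ∈ˢ q → (m ↑ʳ j) ∈ˢ (p Vec.++ q)
  ∈-++⁺ˢʳ {j} j∈q = Vec.lookup⇒[]= (m ↑ʳ j) _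
    (trans (Vec.lookup-++ʳ p q j) (Vec.[]=⇒lookup j∈q))

  ∈-++⁻ˢ : ∀ {a} → a ∈ˢ (p Vec.++ q) →
           (∃[ i ] i ∈ˢ p × a ≡ i ↑ˡ n) ⊎ (∃[ j ] j ∈ˢ q × a ≡ m ↑ʳ j)
  ∈-++⁻ˢ {a} a∈ with splitAt m a in eq
  ... | inj₁ i with refl ← Fin.splitAt⁻¹-↑ˡ {m} eq = inj₁ (i , Vec.lookup⇒[]= i p
    (trans (sym (Vec.lookup-++ˡ p q i)) (Vec.[]=⇒lookup a∈)) , refl)
  ... | inj₂ j with refl ← Fin.splitAt⁻¹-↑ʳ {m} eq = inj₂ (j , Vec.lookup⇒[]= j q
    (trans (sym (Vec.lookup-++ʳ p q j)) (Vec.[]=⇒lookup a∈)) , refl)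

∣p++⊥∣≡∣p∣ : ∀ {m} (p : Subset m) n → ∣ p Vec.++ ⊥ {n} ∣ ≡ ∣ p ∣
∣p++⊥∣≡∣p∣ []            n = ∣⊥∣≡0 n
∣p++⊥∣≡∣p∣ (inside ∷ p)  n = cong suc (∣p++⊥∣≡∣p∣ p n)
∣p++⊥∣≡∣p∣ (outside ∷ p) n = ∣p++⊥∣≡∣p∣ p n

p⊆q∧∣p∣≡∣q∣⇒p≡q : ∀ {n} {p q : Subset n} → p ⊆ˢ q → ∣ p ∣ ≡ ∣ q ∣ → p ≡ q
p⊆q∧∣p∣≡∣q∣⇒p≡q {p = []} {[]} _ _ = refl
p⊆q∧∣p∣≡∣q∣⇒p≡q {p = inside ∷ p} {inside ∷ q} p⊆q eq =
  cong (inside ∷_) (p⊆q∧∣p∣≡∣q∣⇒p≡q (drop-∷-⊆ p⊆q) (ℕ.suc-injective eq))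
p⊆q∧∣p∣≡∣q∣⇒p≡q {p = inside ∷ p} {outside ∷ q} p⊆q _ with () ← p⊆q here
p⊆q∧∣p∣≡∣q∣⇒p≡q {p = outside ∷ p} {inside ∷ q} p⊆q eq =
  contradiction (subst (ℕ._≤ ∣ q ∣) eq (p⊆q⇒∣p∣≤∣q∣ (drop-∷-⊆ p⊆q))) ℕ.1+n≰n
p⊆q∧∣p∣≡∣q∣⇒p≡q {p = outside ∷ p} {outside ∷ q} p⊆q eq =
  cong (outside ∷_) (p⊆q∧∣p∣≡∣q∣⇒p≡q (drop-∷-⊆ p⊆q) eq)

∣p∣≡1⇒p≡⁅x⁆ : ∀ {n} {p : Subset n} {i} → ∣ p ∣ ≡ 1 → i ∈ˢ p → p ≡ ⁅ i ⁆
∣p∣≡1⇒p≡⁅x⁆ {p = p} {i} eq i∈p = sym (p⊆q∧∣p∣≡∣q∣⇒p≡q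
  (λ j∈ → subst (_∈ˢ p) (sym (x∈⁅y⁆⇒x≡y i j∈)) i∈p)
  (trans (∣⁅x⁆∣≡1 i) (sym eq)))

∣p∣≥1⇒Nonempty : ∀ {n} (p : Subset n) → 1 ℕ.≤ ∣ p ∣ → Nonempty p
∣p∣≥1⇒Nonempty (inside ∷ p)  _   = zero , here
∣p∣≥1⇒Nonempty (outside ∷ p) 1≤∣p∣ = let i , i∈p = ∣p∣≥1⇒Nonempty p 1≤∣p∣ in
  suc i , there i∈p

∣p∣≥2⇒distinct : ∀ {n} (p : Subset n) → 2 ℕ.≤ ∣ p ∣ →
                 ∃[ i ] ∃[ j ] i ∈ˢ p × j ∈ˢ p × i ≢ j
∣p∣≥2⇒distinct (inside ∷ p) (s≤s 1≤∣p∣) = let j , j∈p = ∣p∣≥1⇒Nonempty p 1≤∣p∣ in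
  zero , suc j , here , there j∈p , λ ()
∣p∣≥2⇒distinct (outside ∷ p) 2≤∣p∣ = let i , j , i∈p , j∈p , i≢j = ∣p∣≥2⇒distinct p 2≤∣p∣ in
  suc i , suc j , there i∈p , there j∈p , i≢j ∘ Fin.suc-injective

maximum : ∀ {n} (p : Subset n) → Nonempty p →
          ∃[ t ] t ∈ˢ p × (∀ {i} → i ∈ˢ p → i Fin.≤ t)
maximum (s ∷ p) ne with nonempty? p
... | yes ne′ = let t , t∈p , max = maximum p ne′ in
  suc t , there t∈p , λ where
    here        → z≤n
    (there i∈p) → s≤s (max i∈p)
maximum (s ∷ p) (zero , here) | no empty = zero , here , λ where
  here        → z≤n
  (there i∈p) → contradiction (_ , i∈p) empty
maximum (s ∷ p) (suc i , there i∈p) | no empty = contradiction (i , i∈p) empty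

comprehension : ∀ {n ℓ} {P : Pred (Fin n) ℓ} → Decidable P →
                ∃[ p ] (∀ {i} → i ∈ˢ p → P i) × (∀ {i} → P i → i ∈ˢ p)
comprehension {P = P} P? = p , sound , complete
  where
  p = Vec.tabulate (does ∘ P?)

  sound : ∀ {i} → i ∈ˢ p → P i
  sound {i} i∈p with P? i | trans (sym (Vec.lookup∘tabulate (does ∘ P?) i)) (Vec.[]=⇒lookup i∈p)
  ... | yes Pi | _  = Pi
  ... | no _   | ()

  complete : ∀ {i} → P i → i ∈ˢ p
  complete {i} Pi = Vec.lookup⇒[]= i p
    (trans (Vec.lookup∘tabulate (does ∘ P?) i) (dec-true (P? i) Pi))

-- The entries of `p` are copied one by one. If the required size is used up first, the rest is left
-- empty and `q` is contained in `p`; if at an `outside` entry the required size equals the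
-- remaining length, the rest is filled and `q` contains `p`.
comparable-of-size : ∀ {n} k → k ℕ.≤ n → (p : Subset n) →
                     ∃[ q ] ∣ q ∣ ≡ k × (q ⊆ˢ p ⊎ p ⊆ˢ q)
comparable-of-size {n} zero k≤n p = ⊥ , ∣⊥∣≡0 n , inj₁ (⊆-min p)
comparable-of-size (suc k) (s≤s k≤n) (inside ∷ p) =
  let q , ∣q∣≡k , q~p = comparable-of-size k k≤n p in
  inside ∷ q , cong suc ∣q∣≡k , Sum.map s⊆s s⊆s q~p
comparable-of-size (suc k) 1+k≤1+n (outside ∷ p) with ℕ.m≤n⇒m<n∨m≡n 1+k≤1+n
... | inj₁ (s≤s 1+k≤n) =
  let q , ∣q∣≡k , q~p = comparable-of-size (suc k) 1+k≤n p in
  outside ∷ q , ∣q∣≡k , Sum.map s⊆s s⊆s q~p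
... | inj₂ refl = ⊤ , ∣⊤∣≡n _ , inj₂ (⊆-max _)

-- Enumeration of the `k`-element subsets

subsetsOfSize : (n k : ℕ) → List (Subset n)
subsetsOfSize zero    zero    = [] ∷ []
subsetsOfSize zero    (suc k) = []
subsetsOfSize (suc n) zero    = map (outside ∷_) (subsetsOfSize n zero)
subsetsOfSize (suc n) (suc k) =
  map (inside ∷_) (subsetsOfSize n k) ++ map (outside ∷_) (subsetsOfSize n (suc k))

-- The recursion of `subsetsOfSize` on the first entry is Pascal's rule.
length-subsetsOfSize : ∀ n k → length (subsetsOfSize n k) ≡ n C k
length-subsetsOfSize zero    zero    = refl
length-subsetsOfSize zero    (suc k) = refl
length-subsetsOfSize (suc n) zero    =
  trans (length-map (outside ∷_) (subsetsOfSize n zero)) (length-subsetsOfSize n zero)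
length-subsetsOfSize (suc n) (suc k) = trans
  (trans (length-++ (map (inside ∷_) (subsetsOfSize n k)))
    (cong₂ ℕ._+_
      (trans (length-map _ (subsetsOfSize n k)) (length-subsetsOfSize n k))
      (trans (length-map _ (subsetsOfSize n (suc k))) (length-subsetsOfSize n (suc k)))))
  (nCk+nC[k+1]≡[n+1]C[k+1] n k)

∈-subsetsOfSize : ∀ {n} (p : Subset n) → p ∈ subsetsOfSize n ∣ p ∣
∈-subsetsOfSize []           = here refl
∈-subsetsOfSize (inside ∷ p) = ∈-++⁺ˡ (∈-map⁺ (inside ∷_) (∈-subsetsOfSize p))
-- The enumeration branches on whether the size is zero, so the size is abstracted together with the
-- induction hypothesis.
∈-subsetsOfSize (outside ∷ p) with ∣ p ∣ | ∈-subsetsOfSize p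
... | zero  | p∈ = ∈-map⁺ (outside ∷_) p∈
... | suc k | p∈ = ∈-++⁺ʳ (map (inside ∷_) (subsetsOfSize _ k)) (∈-map⁺ (outside ∷_) p∈)

subsetsOfSize-size : ∀ n k → All.All (λ p → ∣ p ∣ ≡ k) (subsetsOfSize n k)
subsetsOfSize-size zero    zero    = All._∷_ {x = []} refl All.[]
subsetsOfSize-size zero    (suc k) = All.[]
subsetsOfSize-size (suc n) zero    = All.map⁺ {f = outside ∷_} (subsetsOfSize-size n zero)
subsetsOfSize-size (suc n) (suc k) = All.++⁺
  (All.map⁺ {f = inside ∷_} (All.map (cong suc) (subsetsOfSize-size n k)))
  (All.map⁺ {f = outside ∷_} (subsetsOfSize-size n (suc k)))

subsetsOfSize-unique : ∀ n k → Unique (subsetsOfSize n k)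
subsetsOfSize-unique zero    zero    = All.[] ∷ []
subsetsOfSize-unique zero    (suc k) = []
subsetsOfSize-unique (suc n) zero    =
  Unique.map⁺ Vec.∷-injectiveʳ (subsetsOfSize-unique n zero)
subsetsOfSize-unique (suc n) (suc k) = Unique.++⁺
  (Unique.map⁺ Vec.∷-injectiveʳ (subsetsOfSize-unique n k))
  (Unique.map⁺ Vec.∷-injectiveʳ (subsetsOfSize-unique n (suc k)))
  disjoint′
  where
  disjoint′ : ∀ {p} → ¬ (p ∈ map (inside ∷_) (subsetsOfSize n k) ×
                         p ∈ map (outside ∷_) (subsetsOfSize n (suc k)))
  disjoint′ (p∈ , p∈′) with ∈-map⁻ _ p∈ | ∈-map⁻ _ p∈′
  ... | _ , _ , refl | _ , _ , ()

-- Counting by representatives in a list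

lookup-injective : ∀ {a} {A : Set a} {xs : List A} → Unique xs →
                   ∀ i j → lookup xs i ≡ lookup xs j → i ≡ j
lookup-injective {xs = _ ∷ _} _ zero zero _ = refl
lookup-injective {xs = _ ∷ _} u zero (suc j) eq =
  contradiction (subst (_∈ _) (sym eq) (∈-lookup j)) (Unique.Unique[x∷xs]⇒x∉xs u)
lookup-injective {xs = _ ∷ _} u (suc i) zero eq =
  contradiction (subst (_∈ _) eq (∈-lookup i)) (Unique.Unique[x∷xs]⇒x∉xs u)
lookup-injective {xs = _ ∷ _} (_ ∷ u) (suc i) (suc j) eq = cong suc (lookup-injective u i j eq)

-- The pigeonhole principle: sending `i` to the position of its representative is an injection into
-- `Fin (length ys)`. Every lower bound on a dominating set below is an instance, for a suitable
-- choice of `R`.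
representatives≤length : ∀ {a r} {A : Set a} {m} {ys : List A} (R : Fin m → A → Set r) →
  (∀ i → ∃[ y ] y ∈ ys × R i y) → (∀ {i j y} → R i y → R j y → i ≡ j) → m ℕ.≤ length ys
representatives≤length {ys = ys} R rep R-injective = Fin.injective⇒≤ position-injective
  where
  position : Fin _ → Fin (length ys)
  position i = index (proj₁ (proj₂ (rep i)))

  position-injective : ∀ {i j} → position i ≡ position j → i ≡ j
  position-injective {i} {j} eq with rep i | rep j
  ... | y , y∈ , Riy | z , z∈ , Rjz = R-injective Riy (subst (R j) (sym y≡z) Rjz)
    where
    y≡z : y ≡ z
    y≡z = trans (lookup-index y∈) (trans (cong (lookup ys) eq) (sym (lookup-index z∈)))

-- The graph

module _ (n k : ℕ) (x : Fin n → ℝ) (x-pos : ∀ i → 0ℝ < x i)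
         (x-mono : ∀ {i j} → i Fin.< j → x i < x j) where

  open KneserB n k x

  x-injective : ∀ {i j} → x i ≈ x j → i ≡ j
  x-injective {i} {j} (xi≤xj , xj≤xi) with Fin.<-cmp i j
  ... | tri< i<j _ _ = contradiction xj≤xi (<⇒≱ (x i) (x j) (x-mono i<j))
  ... | tri≈ _ i≡j _ = i≡j
  ... | tri> _ _ j<i = contradiction xi≤xj (<⇒≱ (x j) (x i) (x-mono j<i))

  x-mono-≤ : ∀ {i j} → i Fin.≤ j → x i ≤ x j
  x-mono-≤ {i} {j} i≤j with Fin.<-cmp i j
  ... | tri< i<j _ _  = <⇒≤ (x i) (x j) (x-mono i<j)
  ... | tri≈ _ refl _ = λ _ → id
  ... | tri> _ _ j<i  = contradiction i≤j (ℕ.<⇒≱ j<i)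

  -- By `abs-element` this is the index of the absolute value among the `x i`. Working with it
  -- replaces comparisons of reals by decidable comparisons in `Fin n`.
  ∣_∣ᵢ : Index → Fin n
  ∣ a ∣ᵢ = [ id , (λ j → inject≤ j (ℕ.m∸n≤m n 1)) ]′ (splitAt n a)

  ∣↑ˡ∣ᵢ : ∀ i → ∣ i ↑ˡ (n ∸ 1) ∣ᵢ ≡ i
  ∣↑ˡ∣ᵢ i rewrite Fin.splitAt-↑ˡ n i (n ∸ 1) = refl

  ∣↑ʳ∣ᵢ : ∀ j → ∣ n ↑ʳ j ∣ᵢ ≡ inject≤ j (ℕ.m∸n≤m n 1)
  ∣↑ʳ∣ᵢ j rewrite Fin.splitAt-↑ʳ n (n ∸ 1) j = refl

  element-↑ˡ : ∀ i → element (i ↑ˡ (n ∸ 1)) ≡ x i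
  element-↑ˡ i rewrite Fin.splitAt-↑ˡ n i (n ∸ 1) = refl

  element-↑ʳ : ∀ j → element (n ↑ʳ j) ≡ - x (inject≤ j (ℕ.m∸n≤m n 1))
  element-↑ʳ j rewrite Fin.splitAt-↑ʳ n (n ∸ 1) j = refl

  abs-element : ∀ a → abs (element a) ≈ x ∣ a ∣ᵢ
  abs-element a with splitAt n a
  ... | inj₁ i = abs-pos (x i) (x-pos i)
  ... | inj₂ j = abs-neg (x _) (x-pos _)

  -- Injectivity and monotonicity of `x` carry the conditions on absolute values over to indices.
  -- The witness `t ↑ˡ (n ∸ 1)` lies in the positive half of the enumeration, so the largest element
  -- is positive.
  φ-intro : ∀ {Y t} → (∀ {a b} → a ∈ˢ Y → b ∈ˢ Y → ∣ a ∣ᵢ ≡ ∣ b ∣ᵢ → a ≡ b) →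
            (t ↑ˡ (n ∸ 1)) ∈ˢ Y → (∀ {b} → b ∈ˢ Y → ∣ b ∣ᵢ Fin.≤ t) → φ Y
  φ-intro {t = t} ∣∣ᵢ-injective t∈Y max = record
    { nonempty     = _ , t∈Y
    ; distinct-abs = λ {a} {b} a∈Y b∈Y a≢b ∣a∣≈∣b∣ → a≢b (∣∣ᵢ-injective a∈Y b∈Y (x-injective
        (≈-trans (x ∣ a ∣ᵢ) (abs (element a)) (x ∣ b ∣ᵢ)
          (≈-sym (abs (element a)) (x ∣ a ∣ᵢ) (abs-element a))
          (≈-trans (abs (element a)) (abs (element b)) (x ∣ b ∣ᵢ) ∣a∣≈∣b∣ (abs-element b)))))
    ; max-positive = t ↑ˡ (n ∸ 1) , t∈Y
        , (λ {b} b∈Y q → proj₂ (abs-element (t ↑ˡ (n ∸ 1))) q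
                       ∘ x-mono-≤ (subst (∣ b ∣ᵢ Fin.≤_) (sym (∣↑ˡ∣ᵢ t)) (max b∈Y)) q
                       ∘ proj₁ (abs-element b) q)
        , subst (0ℝ <_) (sym (element-↑ˡ t)) (x-pos t)
    }

  -- Positive sets and the vertices of `V₁`

  Negative : SubsetB → Set
  Negative Y = ∃[ j ] (n ↑ʳ j) ∈ˢ Y

  positive : Subset n → SubsetB
  positive X = X Vec.++ ⊥

  positive-¬Negative : ∀ X → ¬ Negative (positive X)
  positive-¬Negative X (j , j∈) = ∉⊥ (Vec.lookup⇒[]= j ⊥
    (trans (sym (Vec.lookup-++ʳ X ⊥ j)) (Vec.[]=⇒lookup j∈)))

  ∈-positive⁻ : ∀ {X a} → a ∈ˢ positive X → ∃[ i ] i ∈ˢ X × a ≡ i ↑ˡ (n ∸ 1)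
  ∈-positive⁻ {X} a∈ with ∈-++⁻ˢ {p = X} a∈
  ... | inj₁ p           = p
  ... | inj₂ (_ , j∈⊥ , _) = contradiction j∈⊥ ∉⊥

  ⟦positive⟧⁻ : ∀ X r → ⟦ positive X ⟧ r → ∃[ i ] i ∈ˢ X × r ≈ x i
  ⟦positive⟧⁻ X r (a , a∈ , r≈a) with ∈-positive⁻ {X} a∈
  ... | i , i∈X , refl = i , i∈X , subst (r ≈_) (element-↑ˡ i) r≈a

  ⟦positive⟧⁺ : ∀ {X} r {i} → i ∈ˢ X → r ≈ x i → ⟦ positive X ⟧ r
  ⟦positive⟧⁺ {X} r {i} i∈X r≈xi =
    i ↑ˡ (n ∸ 1) , ∈-++⁺ˢˡ i∈X , subst (r ≈_) (sym (element-↑ˡ i)) r≈xi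

  V₁-positive : ∀ {X} → ∣ X ∣ ≡ k → V₁ (positive X)
  V₁-positive {X} ∣X∣≡k = trans (∣p++⊥∣≡∣p∣ X (n ∸ 1)) ∣X∣≡k ,
    λ {r} r∈ → let i , _ , r≈xi = ⟦positive⟧⁻ X r r∈ in i , r≈xi

  V₁⇒¬Negative : ∀ {S} → V₁ S → ¬ Negative S
  V₁⇒¬Negative (_ , S⊆𝓑⁺) (j , j∈S) =
    let i , -xj≈xi = S⊆𝓑⁺ {element (n ↑ʳ j)} (n ↑ʳ j , j∈S , ≈-refl (element (n ↑ʳ j))) in
    pos≰neg (x i) (x _) (x-pos i) (x-pos _) (subst (x i ≤_) (element-↑ʳ j) (proj₂ -xj≈xi))

  -- With no negative index the second half of the vector is `⊥`. Together with `V₁-positive` this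
  -- identifies `V₁` with the `k`-element subsets of `Fin n`.
  V₁⇒positive : ∀ {S} → V₁ S → ∃[ X ] S ≡ positive X × ∣ X ∣ ≡ k
  V₁⇒positive {S} v₁@(∣S∣≡k , _) with Vec.splitAt n S
  ... | X , N , refl with refl ← Empty-unique {p = N}
      (λ (j , j∈N) → V₁⇒¬Negative v₁ (j , ∈-++⁺ˢʳ {p = X} j∈N)) =
    X , refl , trans (sym (∣p++⊥∣≡∣p∣ X (n ∸ 1))) ∣S∣≡k

  -- Y† = {xᵢ : i ∈ X}
  Supports : Subset n → SubsetB → Set
  Supports X Y = (∀ {a} → a ∈ˢ Y → ∣ a ∣ᵢ ∈ˢ X)
               × (∀ {i} → i ∈ˢ X → ∃[ a ] a ∈ˢ Y × ∣ a ∣ᵢ ≡ i)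

  support : ∀ Y → ∃[ X ] Supports X Y
  support Y = let X , sound , complete = comprehension
                    (λ i → Fin.any? (λ a → (a ∈? Y) ×-dec (∣ a ∣ᵢ Fin.≟ i))) in
              X , (λ a∈Y → complete (_ , a∈Y , refl)) , sound

  Supports-unique : ∀ {X X′ Y} → Supports X Y → Supports X′ Y → X ≡ X′
  Supports-unique {Y = Y} supp supp′ = ⊆-antisym (sub supp supp′) (sub supp′ supp)
    where
    sub : ∀ {X X′} → Supports X Y → Supports X′ Y → X ⊆ˢ X′
    sub {X′ = X′} (_ , lift) (∣∣∈ , _) i∈X = let a , a∈Y , ∣a∣≡i = lift i∈X in
      subst (_∈ˢ X′) ∣a∣≡i (∣∣∈ a∈Y)

  Supports-positive : ∀ X → Supports X (positive X)
  Supports-positive X = ∣∣∈ , λ {i} i∈X → i ↑ˡ (n ∸ 1) , ∈-++⁺ˢˡ i∈X , ∣↑ˡ∣ᵢ i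
    where
    ∣∣∈ : ∀ {a} → a ∈ˢ positive X → ∣ a ∣ᵢ ∈ˢ X
    ∣∣∈ a∈ with ∈-positive⁻ {X} a∈
    ... | i , i∈X , refl = subst (_∈ˢ X) (sym (∣↑ˡ∣ᵢ i)) i∈X

  -- Comparability in terms of supports

  †⁻ : ∀ {X Y} r → Supports X Y → (Y †) r → ∃[ i ] i ∈ˢ X × r ≈ x i
  †⁻ r (∣∣∈ , _) (a , a∈Y , r≈∣a∣) = ∣ a ∣ᵢ , ∣∣∈ a∈Y ,
    ≈-trans r (abs (element a)) (x ∣ a ∣ᵢ) r≈∣a∣ (abs-element a)

  †⁺ : ∀ {X Y} r {i} → Supports X Y → i ∈ˢ X → r ≈ x i → (Y †) r
  †⁺ r (_ , lift) i∈X r≈xi with lift i∈X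
  ... | a , a∈Y , refl = a , a∈Y ,
    ≈-trans r (x ∣ a ∣ᵢ) (abs (element a)) r≈xi (≈-sym (abs (element a)) (x ∣ a ∣ᵢ) (abs-element a))

  -- Each inclusion of sets of reals is tested at the points `x i`, and injectivity of `x` brings it
  -- back to indices. With the converse `Comparable⁺`, adjacency becomes a question about subsets of
  -- `Fin n`.
  Comparable⁻ : ∀ {X Y Z} → Supports X Y → Comparable (positive Z) Y → Z ⊆ˢ X ⊎ X ⊆ˢ Z
  Comparable⁻ {X} {Y} {Z} supp = Sum.map
    (λ Z⊆Y† {i} i∈Z →
      let j , j∈X , xi≈xj = †⁻ (x i) supp (Z⊆Y† {x i} (⟦positive⟧⁺ (x i) i∈Z (≈-refl (x i)))) in
      subst (_∈ˢ X) (sym (x-injective xi≈xj)) j∈X)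
    (λ Y†⊆Z {i} i∈X →
      let j , j∈Z , xi≈xj = ⟦positive⟧⁻ Z (x i) (Y†⊆Z {x i} (†⁺ (x i) supp i∈X (≈-refl (x i)))) in
      subst (_∈ˢ Z) (sym (x-injective xi≈xj)) j∈Z)

  Comparable⁺ : ∀ {X Y Z} → Supports X Y → Z ⊆ˢ X ⊎ X ⊆ˢ Z → Comparable (positive Z) Y
  Comparable⁺ {X} {Y} {Z} supp = Sum.map
    (λ Z⊆X {r} r∈Z → let i , i∈Z , r≈xi = ⟦positive⟧⁻ Z r r∈Z in †⁺ r supp (Z⊆X i∈Z) r≈xi)
    (λ X⊆Z {r} r∈Y† → let i , i∈X , r≈xi = †⁻ r supp r∈Y† in ⟦positive⟧⁺ r (X⊆Z i∈X) r≈xi)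

  -- Construction of members of `φ`

  φ-positive : ∀ {X} → Nonempty X → φ (positive X)
  φ-positive {X} ne = let t , t∈X , max = maximum X ne in
    φ-intro ∣∣ᵢ-injective (∈-++⁺ˢˡ t∈X) (max ∘ proj₁ (Supports-positive X))
    where
    ∣∣ᵢ-injective : ∀ {a b} → a ∈ˢ positive X → b ∈ˢ positive X → ∣ a ∣ᵢ ≡ ∣ b ∣ᵢ → a ≡ b
    ∣∣ᵢ-injective a∈ b∈ eq with ∈-positive⁻ {X} a∈ | ∈-positive⁻ {X} b∈
    ... | i , _ , refl | j , _ , refl =
      cong (_↑ˡ (n ∸ 1)) (trans (sym (∣↑ˡ∣ᵢ i)) (trans eq (∣↑ˡ∣ᵢ j)))

  -- Since -xₙ ∉ 𝓑ₙ, the sign of xᵢ can be changed only below some other index.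
  negativeIndex : ∀ {i t : Fin n} → i Fin.< t → ∃[ j ] inject≤ {n ∸ 1} j (ℕ.m∸n≤m n 1) ≡ i
  negativeIndex {i} {t} i<t = fromℕ< i<n-1 ,
    Fin.toℕ-injective (trans (Fin.toℕ-inject≤ (fromℕ< i<n-1) (ℕ.m∸n≤m n 1)) (Fin.toℕ-fromℕ< i<n-1))
    where
    i<n-1 : toℕ i ℕ.< n ∸ 1
    i<n-1 = ℕ.≤-trans i<t (Fin.toℕ≤pred[n] t)

  -- Moving `i` from the positive half to the negative half keeps the support, and since `i` is
  -- below the maximum `t`, the element of largest absolute value stays positive.
  flip-sign : ∀ {X i t} → i ∈ˢ X → t ∈ˢ X → i Fin.< t → (∀ {j} → j ∈ˢ X → j Fin.≤ t) →
              ∃[ Y ] Supports X Y × φ Y × Negative Y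
  flip-sign {X} {i} {t} i∈X t∈X i<t max with negativeIndex i<t
  ... | m , refl = Y , supp , φ-intro ∣∣ᵢ-injective (∈-++⁺ˢˡ (∈X∖i t∈X t≢i)) (max ∘ proj₁ supp)
                 , m , ∈-++⁺ˢʳ {p = X∖i} (x∈⁅x⁆ m)
    where
    X∖i = X ∩ ∁ ⁅ i ⁆
    Y = X∖i Vec.++ ⁅ m ⁆

    t≢i : t ≢ i
    t≢i t≡i = Fin.<-irrefl (sym t≡i) i<t

    ∈X∖i : ∀ {j} → j ∈ˢ X → j ≢ i → j ∈ˢ X∖i
    ∈X∖i j∈X j≢i = x∈p∩q⁺ (j∈X , x∉p⇒x∈∁p (x≢y⇒x∉⁅y⁆ j≢i))

    i∉X∖i : ¬ i ∈ˢ X∖i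
    i∉X∖i i∈ = x∈∁p⇒x∉p (proj₂ (x∈p∩q⁻ X _ i∈)) (x∈⁅x⁆ i)

    ∈Y⁻ : ∀ {a} → a ∈ˢ Y → (∃[ j ] j ∈ˢ X∖i × a ≡ j ↑ˡ (n ∸ 1)) ⊎ a ≡ n ↑ʳ m
    ∈Y⁻ a∈ with ∈-++⁻ˢ {p = X∖i} a∈
    ... | inj₁ p = inj₁ p
    ... | inj₂ (j , j∈ , refl) = inj₂ (cong (n ↑ʳ_) (x∈⁅y⁆⇒x≡y m j∈))

    ∣∣∈ : ∀ {a} → a ∈ˢ Y → ∣ a ∣ᵢ ∈ˢ X
    ∣∣∈ a∈ with ∈Y⁻ a∈
    ... | inj₁ (j , j∈ , refl) = subst (_∈ˢ X) (sym (∣↑ˡ∣ᵢ j)) (proj₁ (x∈p∩q⁻ X _ j∈))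
    ... | inj₂ refl            = subst (_∈ˢ X) (sym (∣↑ʳ∣ᵢ m)) i∈X

    lift : ∀ {j} → j ∈ˢ X → ∃[ a ] a ∈ˢ Y × ∣ a ∣ᵢ ≡ j
    lift {j} j∈X with j Fin.≟ i
    ... | yes refl = n ↑ʳ m , ∈-++⁺ˢʳ {p = X∖i} (x∈⁅x⁆ m) , ∣↑ʳ∣ᵢ m
    ... | no j≢i   = j ↑ˡ (n ∸ 1) , ∈-++⁺ˢˡ (∈X∖i j∈X j≢i) , ∣↑ˡ∣ᵢ j

    supp : Supports X Y
    supp = ∣∣∈ , lift

    ∣∣ᵢ-injective : ∀ {a b} → a ∈ˢ Y → b ∈ˢ Y → ∣ a ∣ᵢ ≡ ∣ b ∣ᵢ → a ≡ b
    ∣∣ᵢ-injective a∈ b∈ eq with ∈Y⁻ a∈ | ∈Y⁻ b∈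
    ... | inj₁ (j , j∈ , refl) | inj₁ (l , l∈ , refl) =
      cong (_↑ˡ (n ∸ 1)) (trans (sym (∣↑ˡ∣ᵢ j)) (trans eq (∣↑ˡ∣ᵢ l)))
    -- The index `m` stands for the negative of `x i`, so equal absolute values would force `j` to
    -- be `i`, which was removed from the positive half.
    ... | inj₁ (j , j∈ , refl) | inj₂ refl = contradiction
      (subst (_∈ˢ X∖i) (trans (sym (∣↑ˡ∣ᵢ j)) (trans eq (∣↑ʳ∣ᵢ m))) j∈) i∉X∖i
    ... | inj₂ refl | inj₁ (j , j∈ , refl) = contradiction
      (subst (_∈ˢ X∖i) (trans (sym (∣↑ˡ∣ᵢ j)) (trans (sym eq) (∣↑ʳ∣ᵢ m))) j∈) i∉X∖i
    ... | inj₂ refl | inj₂ refl = refl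

  -- Of two distinct members of `X` at least one is not the maximum, so its sign can be changed. The
  -- negative element keeps the result out of `V₁`.
  negative-copy : ∀ {X i j} → i ∈ˢ X → j ∈ˢ X → i ≢ j → ∃[ Y ] Supports X Y × V₂ Y × Negative Y
  negative-copy {X} {i} {j} i∈X j∈X i≢j with maximum X (i , i∈X)
  ... | t , t∈X , max = let Y , supp , φY , neg = flipped in
    Y , supp , (φY , λ v₁ → V₁⇒¬Negative v₁ neg) , neg
    where
    flipped : ∃[ Y ] Supports X Y × φ Y × Negative Y
    flipped with i Fin.≟ t
    ... | no i≢t   = flip-sign i∈X t∈X (Fin.≤∧≢⇒< (max i∈X) i≢t) max
    ... | yes refl = flip-sign j∈X t∈X (Fin.≤∧≢⇒< (max j∈X) (i≢j ∘ sym)) max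

  -- Upper bound: the vertices of `V₁` dominate

  V₁-list : List SubsetB
  V₁-list = map positive (subsetsOfSize n k)

  V₁⇒∈V₁-list : ∀ {S} → V₁ S → S ∈ V₁-list
  V₁⇒∈V₁-list v₁ with V₁⇒positive v₁
  ... | X , refl , refl = ∈-map⁺ positive (∈-subsetsOfSize X)

  V₁-dominating : k ℕ.≤ n → DominatingSet H_B V₁-list
  V₁-dominating k≤n = record
    { unique    = Unique.map⁺ (Vec.++-injectiveˡ _ _) (subsetsOfSize-unique n k)
    ; vertices  = All.map⁺ (All.map (inj₁ ∘ V₁-positive) (subsetsOfSize-size n k))
    ; dominates = λ where
        (inj₁ v₁)     S∉ → contradiction (V₁⇒∈V₁-list v₁) S∉
        {S} (inj₂ v₂) _  →
          let X , supp        = support S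
              Z , ∣Z∣≡k , Z~X = comparable-of-size k k≤n X
              v₁              = V₁-positive ∣Z∣≡k
          in positive Z , V₁⇒∈V₁-list v₁ , inj₂ (v₁ , v₂ , Comparable⁺ supp Z~X)
    }

  -- Lower bound for an arbitrary dominating set

  module _ {D : List SubsetB} (dom : DominatingSet H_B D) where

    open DominatingSet dom
    open import Data.List.Membership.DecPropositional (Vec.≡-dec {n = n ℕ.+ (n ∸ 1)} _≟ᵇ_)
      using () renaming (_∈?_ to _∈ᴸ?_)

    -- A vertex of `V₂` is not in `V₁`, so all its neighbours are in `V₁` and hence of the form
    -- `positive Z`.
    V₂-covered : ∀ {X Y} → Supports X Y → V₂ Y →
                 Y ∈ D ⊎ ∃[ Z ] ∣ Z ∣ ≡ k × positive Z ∈ D × (Z ⊆ˢ X ⊎ X ⊆ˢ Z)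
    V₂-covered {Y = Y} supp v₂ with Y ∈ᴸ? D
    ... | yes Y∈D = inj₁ Y∈D
    ... | no Y∉D with dominates (inj₂ v₂) Y∉D
    ... | _ , _   , inj₁ (v₁ , _)       = contradiction v₁ (proj₂ v₂)
    ... | T , T∈D , inj₂ (v₁ , _ , T~Y) with V₁⇒positive v₁
    ... | Z , refl , ∣Z∣≡k = inj₂ (Z , ∣Z∣≡k , T∈D , Comparable⁻ supp T~Y)

    -- By cardinality, a `k`-set comparable to `X` is `X` itself. So `D` contains either the copy of
    -- `X` with a changed sign or `positive X`, and both have support `X`.
    signed-copy-∈D : ∀ X → 2 ℕ.≤ k → ∣ X ∣ ≡ k → ∃[ Y ] Y ∈ D × Supports X Y
    signed-copy-∈D X 2≤k ∣X∣≡k with ∣p∣≥2⇒distinct X (subst (2 ℕ.≤_) (sym ∣X∣≡k) 2≤k)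
    ... | i , j , i∈X , j∈X , i≢j with negative-copy i∈X j∈X i≢j
    ... | Y , supp , v₂ , _ with V₂-covered supp v₂
    ... | inj₁ Y∈D = Y , Y∈D , supp
    ... | inj₂ (Z , ∣Z∣≡k , Z∈D , Z~X) =
      positive X , subst (λ p → positive p ∈ D) (Z≡X Z~X) Z∈D , Supports-positive X
      where
      Z≡X : Z ⊆ˢ X ⊎ X ⊆ˢ Z → Z ≡ X
      Z≡X (inj₁ Z⊆X) = p⊆q∧∣p∣≡∣q∣⇒p≡q Z⊆X (trans ∣Z∣≡k (sym ∣X∣≡k))
      Z≡X (inj₂ X⊆Z) = sym (p⊆q∧∣p∣≡∣q∣⇒p≡q X⊆Z (trans ∣X∣≡k (sym ∣Z∣≡k)))

    nCk≤length : 2 ℕ.≤ k → n C k ℕ.≤ length D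
    nCk≤length 2≤k = subst (ℕ._≤ length D) (length-subsetsOfSize n k)
      -- A member of `D` has only one support, so it represents only one `k`-set.
      (representatives≤length (λ i → Supports (lookup L i))
        (λ i → signed-copy-∈D _ 2≤k (All.lookup (subsetsOfSize-size n k) (∈-lookup i)))
        (λ supp supp′ → lookup-injective (subsetsOfSize-unique n k) _ _
                          (Supports-unique supp supp′)))
      where
      L = subsetsOfSize n k

    -- Lower bound for `k = 1`

    module _ (k≡1 : k ≡ 1) where

      Missing : Fin n → Set
      Missing i = positive ⁅ i ⁆ ∉ D

      -- A singleton inside the support would be one of the two missing ones, and a singleton cannot
      -- contain two distinct indices. No neighbour of `Y` is therefore in `D`.
      pair-∈D : ∀ {i t Y} → i ≢ t → Missing i → Missing t →
                Supports (⁅ i ⁆ ∪ ⁅ t ⁆) Y → V₂ Y → Y ∈ D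
      pair-∈D {i} {t} i≢t i∉D t∉D supp v₂ with V₂-covered supp v₂
      ... | inj₁ Y∈D = Y∈D
      ... | inj₂ (Z , ∣Z∣≡k , Z∈D , inj₁ Z⊆) with
              ∣p∣≥1⇒Nonempty Z (ℕ.≤-reflexive (sym (trans ∣Z∣≡k k≡1)))
      ... | z , z∈Z with ∣p∣≡1⇒p≡⁅x⁆ (trans ∣Z∣≡k k≡1) z∈Z | x∈p∪q⁻ ⁅ i ⁆ ⁅ t ⁆ (Z⊆ z∈Z)
      ... | refl | inj₁ z∈⁅i⁆ with refl ← x∈⁅y⁆⇒x≡y i z∈⁅i⁆ = contradiction Z∈D i∉D
      ... | refl | inj₂ z∈⁅t⁆ with refl ← x∈⁅y⁆⇒x≡y t z∈⁅t⁆ = contradiction Z∈D t∉D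
      pair-∈D {i} {t} i≢t _ _ supp v₂ | inj₂ (Z , ∣Z∣≡k , _ , inj₂ ⊆Z) =
        contradiction (x∈⁅y⁆⇒x≡y t (subst (i ∈ˢ_)
          (∣p∣≡1⇒p≡⁅x⁆ (trans ∣Z∣≡k k≡1) (⊆Z (x∈p∪q⁺ (inj₂ (x∈⁅x⁆ t)))))
          (⊆Z (x∈p∪q⁺ (inj₁ (x∈⁅x⁆ i)))))) i≢t

      V₂-pair : ∀ {i t} → i ≢ t → V₂ (positive (⁅ i ⁆ ∪ ⁅ t ⁆))
      V₂-pair {i} {t} i≢t = φ-positive (i , i∈) , λ (∣S∣≡k , _) →
        i≢t (x∈⁅y⁆⇒x≡y t (subst (i ∈ˢ_)
          (∣p∣≡1⇒p≡⁅x⁆ (trans (sym (∣p++⊥∣≡∣p∣ (⁅ i ⁆ ∪ ⁅ t ⁆) (n ∸ 1))) (trans ∣S∣≡k k≡1))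
            (x∈p∪q⁺ (inj₂ (x∈⁅x⁆ t)))) i∈))
        where
        i∈ : i ∈ˢ (⁅ i ⁆ ∪ ⁅ t ⁆)
        i∈ = x∈p∪q⁺ (inj₁ (x∈⁅x⁆ i))

      -- This covers both `⁅ i ⁆` and `⁅ i ⁆ ∪ ⁅ t ⁆`. When `i ≢ t`, the index `i` can be recovered
      -- as the only member of `Z` other than `t`.
      Charged : (t i : Fin n) → SubsetB → Set
      Charged t i Y = ∃[ Z ] Y ≡ positive Z × i ∈ˢ Z × (∀ {j} → j ∈ˢ Z → j ≡ i ⊎ j ≡ t)

      charge : ∀ {t} → Missing t → ∀ i → i ≢ t → ∃[ Y ] Y ∈ D × Charged t i Y
      charge {t} t∉D i i≢t with positive ⁅ i ⁆ ∈ᴸ? D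
      ... | yes i∈D = _ , i∈D , ⁅ i ⁆ , refl , x∈⁅x⁆ i , inj₁ ∘ x∈⁅y⁆⇒x≡y i
      ... | no i∉D  = _ , pair-∈D i≢t i∉D t∉D (Supports-positive _) (V₂-pair i≢t)
        , ⁅ i ⁆ ∪ ⁅ t ⁆ , refl , x∈p∪q⁺ (inj₁ (x∈⁅x⁆ i))
        , Sum.map (x∈⁅y⁆⇒x≡y i) (x∈⁅y⁆⇒x≡y t) ∘ x∈p∪q⁻ ⁅ i ⁆ ⁅ t ⁆

      -- The index `t` is represented by `Y₀`, every other index by a vertex charged to it;
      -- excluding `Y₀` from the latter keeps the representatives distinct.
      n≤length-from : ∀ {t Y₀} → Y₀ ∈ D →
                      (∀ i → i ≢ t → ∃[ Y ] Y ∈ D × Charged t i Y × Y ≢ Y₀) →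
                      n ℕ.≤ length D
      n≤length-from {t} {Y₀} Y₀∈D charged = representatives≤length R represent R-injective
        where
        R : Fin n → SubsetB → Set
        R i Y = (i ≡ t × Y ≡ Y₀) ⊎ (i ≢ t × Charged t i Y × Y ≢ Y₀)

        represent : ∀ i → ∃[ Y ] Y ∈ D × R i Y
        represent i with i Fin.≟ t
        ... | yes i≡t = Y₀ , Y₀∈D , inj₁ (i≡t , refl)
        ... | no i≢t  = let Y , Y∈D , c = charged i i≢t in Y , Y∈D , inj₂ (i≢t , c)

        R-injective : ∀ {i j Y} → R i Y → R j Y → i ≡ j
        R-injective (inj₁ (refl , _)) (inj₁ (refl , _)) = refl
        R-injective (inj₁ (_ , Y≡Y₀)) (inj₂ (_ , _ , Y≢Y₀)) = contradiction Y≡Y₀ Y≢Y₀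
        R-injective (inj₂ (_ , _ , Y≢Y₀)) (inj₁ (_ , Y≡Y₀)) = contradiction Y≡Y₀ Y≢Y₀
        R-injective (inj₂ (i≢t , (Z , Y≡Z , i∈Z , _) , _))
                    (inj₂ (_ , (Z′ , Y≡Z′ , _ , only) , _)) with
          Vec.++-injectiveˡ Z Z′ (trans (sym Y≡Z) Y≡Z′)
        -- Both charges name the same `Z`, so `i` is `j` or `t`, and `t` is excluded.
        ... | refl = [ id , (λ i≡t → contradiction i≡t i≢t) ]′ (only i∈Z)

      n≤length : n ℕ.≤ length D
      n≤length with Fin.any? (λ t → ¬? (positive ⁅ t ⁆ ∈ᴸ? D))
      -- All singletons are in `D` and represent their own indices.
      ... | no none = representatives≤length (λ i Y → Y ≡ positive ⁅ i ⁆) all∈D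
          (λ { {i} {j} refl eq → x∈⁅y⁆⇒x≡y j (subst (i ∈ˢ_) (Vec.++-injectiveˡ ⁅ i ⁆ ⁅ j ⁆ eq) (x∈⁅x⁆ i)) })
        where
        all∈D : ∀ i → ∃[ Y ] Y ∈ D × Y ≡ positive ⁅ i ⁆
        all∈D i with positive ⁅ i ⁆ ∈ᴸ? D
        ... | yes i∈D = _ , i∈D , refl
        ... | no i∉D  = contradiction (i , i∉D) none
      ... | yes (t , t∉D) with Fin.any? (λ s → ¬? (positive ⁅ s ⁆ ∈ᴸ? D) ×-dec ¬? (s Fin.≟ t))
      ... | yes (s , s∉D , s≢t) =
        -- The extra vertex is the pair of `s` and `t` with a sign changed. It has a negative
        -- element, which no charged vertex has.
        let Y₀ , supp , v₂ , neg = negative-copy (x∈p∪q⁺ (inj₁ (x∈⁅x⁆ s))) (x∈p∪q⁺ (inj₂ (x∈⁅x⁆ t))) s≢t in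
        n≤length-from (pair-∈D s≢t s∉D t∉D supp v₂) λ i i≢t →
          let Y , Y∈D , c@(Z , Y≡Z , _) = charge t∉D i i≢t in
          Y , Y∈D , c , λ Y≡Y₀ → positive-¬Negative Z (subst Negative (trans (sym Y≡Y₀) Y≡Z) neg)
      -- Every other singleton is in `D` and is charged to its own index. The neighbour `Y₀` of the
      -- missing one is in `V₂`, so it is none of these.
      ... | no only-t with dominates (inj₁ (V₁-positive (trans (∣⁅x⁆∣≡1 t) (sym k≡1)))) t∉D
      ... | _  , _    , inj₂ (_ , (_ , ¬v₁) , _) =
        contradiction (V₁-positive (trans (∣⁅x⁆∣≡1 t) (sym k≡1))) ¬v₁
      ... | Y₀ , Y₀∈D , inj₁ (_ , (_ , ¬v₁) , _) = n≤length-from Y₀∈D charged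
        where
        charged : ∀ i → i ≢ t → ∃[ Y ] Y ∈ D × Charged t i Y × Y ≢ Y₀
        charged i i≢t with positive ⁅ i ⁆ ∈ᴸ? D
        ... | no i∉D  = contradiction (i , i∉D , i≢t) only-t
        ... | yes i∈D = _ , i∈D , (⁅ i ⁆ , refl , x∈⁅x⁆ i , inj₁ ∘ x∈⁅y⁆⇒x≡y i)
          , λ i≡Y₀ → ¬v₁ (subst V₁ i≡Y₀ (V₁-positive (trans (∣⁅x⁆∣≡1 i) (sym k≡1))))

  domination-number : 1 ℕ.≤ k → k ℕ.< n → IsDominationNumber H_B (n C k)
  domination-number 1≤k k<n = record
    { attained = V₁-list , V₁-dominating (ℕ.<⇒≤ k<n)
               , trans (length-map positive (subsetsOfSize n k)) (length-subsetsOfSize n k)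
    -- The hypothesis `1 ≤ k` splits into `2 ≤ k` and `1 ≡ k`; in the second case the binomial
    -- coefficient is `n`.
    ; minimal  = λ D dom → [ nCk≤length dom
                           , (λ 1≡k → subst (ℕ._≤ length D)
                                (trans (sym (nC1≡n n)) (cong (n C_) 1≡k))
                                (n≤length dom (sym 1≡k)))
                           ]′ (ℕ.m≤n⇒m<n∨m≡n 1≤k)
    }

mainTheorem4 : (n k : ℕ) → 2 ℕ.≤ n → 1 ℕ.≤ k → k ℕ.< n →
    (x : Fin n → ℝ) →
    (∀ i → 0ℝ < x i) →
    (∀ {i j} → i Fin.< j → x i < x j) →
    IsDominationNumber (KneserB.H_B n k x) (n C k)
mainTheorem4 n k _ 1≤k k<n x x-pos x-mono = domination-number n k x x-pos x-mono 1≤k k<n
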